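{- Let $q$ be a prime power and let $n\geq 2$ be an integer. There is a bijection between the set $\mathcal{D}(n)$ of distance vectors for the full flag variety on $\mathbb{F}_q^n$ and the set $\mathcal{M}_n$ of Motzkin paths of length $n$.
   Context: Let $\mathbb{F}_q$ be the finite field with $q$ elements. A full flag on $\mathbb{F}_q^n$ is a sequence $\mathcal{F}=(\mathcal{F}_1,\dots,\mathcal{F}_{n-1})$ of $\mathbb{F}_q$-subspaces of $\mathbb{F}_q^n$ with $\mathcal{F}_1\subsetneq\cdots\subsetneq\mathcal{F}_{n-1}$ and $\dim \mathcal{F}_i=i$ for every $i$; the set of all full flags is the full flag variety $\mathcal{F}_q(n)$. For subspaces $\mathcal{U},\mathcal{V}$ of the same dimension $k$, the injection distance is $d_I(\mathcal{U},\mathcal{V})=k-\dim(\mathcal{U}\cap\mathcal{V})$. The distance vector of $\mathcal{F},\mathcal{F}'\in\mathcal{F}_q(n)$ is $\mathbf{d}(\mathcal{F},\mathcal{F}')=(d_I(\mathcal{F}_1,\mathcal{F}'_1),\dots,d_I(\mathcal{F}_{n-1},\mathcal{F}'_{n-1}))\in\mathbb{Z}^{n-1}$, and $\mathcal{D}(n)=\{\mathbf{d}(\mathcal{F},\mathcal{F}') \mid \mathcal{F},\mathcal{F}'\in\mathcal{F}_q(n)\}$ (pairs with $\mathcal{F}=\mathcal{F}'$ are allowed, so the zero vector belongs to $\mathcal{D}(n)$). A Motzkin path of length $n$ is a lattice path in $\mathbb{Z}^2$ from $(0,0)$ to $(n,0)$ with steps $U=(1,1)$, $D=(1,-1)$,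 $H=(1,0)$ that never runs below the $x$-axis; $\mathcal{M}_n$ is the set of these. It is identified with its Motzkin word $p_1p_2\dots p_n$ in the letters $U,D,H$. -}

module Defs where

open import Level using (Level; _⊔_) renaming (suc to lsuc)
open import Algebra.Apartness.Bundles using (HeytingField; HeytingCommutativeRing)
import Algebra.Definitions.RawMonoid as RawMonoidDefinitions
open import Algebra.Bundles using (CommutativeRing)
open import Data.Fin.Base using (Fin; toℕ; _<_)
open import Data.Integer.Base as ℤ using (ℤ; +_; 0ℤ; 1ℤ; -1ℤ)
open import Data.Nat.Base as ℕ using (ℕ; suc; _∸_; _^_)
open import Data.Nat.Primality using (Prime)
open import Data.Product.Base using (Σ; ∃; ∃₂; _×_; _,_; proj₁; proj₂)
open import Data.Vec.Base using (Vec; []; _∷_; lookup; last)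
open import Data.Vec.Functional using (Vector)
import Data.Vec.Functional.Relation.Binary.Equality.Setoid as VectorEquality
open import Data.Vec.Relation.Unary.All using (All)
open import Function.Bundles using (Inverse)
open import Relation.Binary.Bundles using (Setoid)
import Relation.Binary.Construct.On as On
open import Relation.Binary.PropositionalEquality using (_≡_; setoid)
open import Relation.Unary using (Pred; _⊂_; _∩_)

IsPrimePower : ℕ → Set
IsPrimePower q = ∃₂ λ p k → Prime p × 1 ℕ.≤ k × q ≡ p ^ k

-- On a field with finitely many elements the apartness of a HeytingField is
-- necessarily the negation of _≈_, so that such a field is just a finite
-- field in the usual sense.  (Triviality is excluded: in the zero ring 0# - 0#
-- is invertible, which would give 0# # 0#.)
HasCardinality : ∀ {c ℓ₁ ℓ₂} → HeytingField c ℓ₁ ℓ₂ → ℕ → Set (c ⊔ ℓ₁)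
HasCardinality K q = Inverse (HeytingField.setoid K) (setoid (Fin q))

module LinearAlgebra {c ℓ₁ ℓ₂ : Level} (K : HeytingField c ℓ₁ ℓ₂) where

  open HeytingField K hiding (setoid)
  open VectorEquality (HeytingField.setoid K) using (_≋_)
  open CommutativeRing
    (HeytingCommutativeRing.commutativeRing heytingCommutativeRing)
    using (+-rawMonoid)
  open RawMonoidDefinitions +-rawMonoid using (sum)

  0ᵛ : ∀ {n} → Vector Carrier n
  0ᵛ _ = 0#

  infixl 6 _+ᵛ_
  infixl 7 _·ᵛ_

  _+ᵛ_ : ∀ {n} → Vector Carrier n → Vector Carrier n → Vector Carrier n
  (x +ᵛ y) j = x j + y j

  _·ᵛ_ : ∀ {n} → Carrier → Vector Carrier n → Vector Carrier n
  (a ·ᵛ x) j = a * x j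

  linearCombination : ∀ {n k} → Vector Carrier k → Vector (Vector Carrier n) k →
                      Vector Carrier n
  linearCombination a b j = sum (λ i → (a i ·ᵛ b i) j)

  -- The predicate lives at level c ⊔ ℓ₁ because that is the level of the span
  -- of a finite family of vectors.
  record Subspace (n : ℕ) : Set (lsuc (c ⊔ ℓ₁)) where
    field
      member   : Pred (Vector Carrier n) (c ⊔ ℓ₁)
      resp     : ∀ {x y} → x ≋ y → member x → member y
      0-closed : member 0ᵛ
      +-closed : ∀ {x y} → member x → member y → member (x +ᵛ y)
      ·-closed : ∀ a {x} → member x → member (a ·ᵛ x)

  open Subspace public using (member)

  infixr 7 _∩ˢ_

  _∩ˢ_ : ∀ {n} → Subspace n → Subspace n → Subspace n
  V ∩ˢ W = record
    { member   = member V ∩ member W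
    ; resp     = λ { x≋y (v , w) → V.resp x≋y v , W.resp x≋y w }
    ; 0-closed = V.0-closed , W.0-closed
    ; +-closed = λ { (v , w) (v′ , w′) → V.+-closed v v′ , W.+-closed w w′ }
    ; ·-closed = λ { a (v , w) → V.·-closed a v , W.·-closed a w }
    }
    where
    module V = Subspace V
    module W = Subspace W

  LinearlyIndependent : ∀ {n k} → Vector (Vector Carrier n) k → Set (c ⊔ ℓ₁)
  LinearlyIndependent b =
    ∀ a → linearCombination a b ≋ 0ᵛ → ∀ i → a i ≈ 0#

  record IsBasis {n k : ℕ} (W : Subspace n) (b : Vector (Vector Carrier n) k) :
                 Set (c ⊔ ℓ₁) where
    field
      inside      : ∀ i → member W (b i)
      independent : LinearlyIndependent b
      spanning    : ∀ {x} → member W x → ∃ λ a → x ≋ linearCombination a b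

  HasDimension : ∀ {n} → Subspace n → ℕ → Set (c ⊔ ℓ₁)
  HasDimension {n} W k = Σ (Vector (Vector Carrier n) k) (IsBasis W)

  -- d is d_I(V , W) = k - dim (V ∩ W) for V and W of the same dimension k,
  -- given as the graph of the distance since dimension is a relation here.
  IsInjectionDistance : ∀ {n} → Subspace n → Subspace n → ℤ → Set (c ⊔ ℓ₁)
  IsInjectionDistance V W d = ∃₂ λ k m →
    HasDimension V k × HasDimension W k × HasDimension (V ∩ˢ W) m ×
    d ≡ + k ℤ.- + m

  -- The index i : Fin (n ∸ 1) counts from 0, so space i is the member of the
  -- flag of dimension suc (toℕ i).
  record FullFlag (n : ℕ) : Set (lsuc (c ⊔ ℓ₁)) where
    field
      space      : Fin (n ∸ 1) → Subspace n
      increasing : ∀ {i j} → i < j → member (space i) ⊂ member (space j)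
      dimension  : ∀ i → HasDimension (space i) (suc (toℕ i))

  open FullFlag public using (space)

  IsDistanceVector : ∀ {n} → FullFlag n → FullFlag n → Vec ℤ (n ∸ 1) → Set (c ⊔ ℓ₁)
  IsDistanceVector F F′ d =
    ∀ i → IsInjectionDistance (space F i) (space F′ i) (lookup d i)

  DistanceVector : ℕ → Set (lsuc (c ⊔ ℓ₁))
  DistanceVector n = Σ (Vec ℤ (n ∸ 1)) λ d →
    Σ (FullFlag n) λ F → Σ (FullFlag n) λ F′ → IsDistanceVector F F′ d

  -- Elements of 𝒟(n) carry a pair of flags as a witness of membership, but
  -- are compared as vectors only.
  𝒟 : ℕ → Setoid (lsuc (c ⊔ ℓ₁)) Level.zero
  𝒟 n = On.setoid {B = DistanceVector n} (setoid (Vec ℤ (n ∸ 1))) proj₁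

open LinearAlgebra public using (𝒟)

data Step : Set where
  U D H : Step

displacement : Step → ℤ × ℤ
displacement U = 1ℤ , 1ℤ
displacement D = 1ℤ , -1ℤ
displacement H = 1ℤ , 0ℤ

infixl 6 _⊹_

_⊹_ : ℤ × ℤ → ℤ × ℤ → ℤ × ℤ
(x , y) ⊹ (x′ , y′) = x ℤ.+ x′ , y ℤ.+ y′

-- All lattice points visited, the starting point included.
points : ∀ {n} → ℤ × ℤ → Vec Step n → Vec (ℤ × ℤ) (suc n)
points p []      = p ∷ []
points p (s ∷ w) = p ∷ points (p ⊹ displacement s) w

record IsMotzkin {n : ℕ} (w : Vec Step n) : Set where
  field
    endpoint   : last (points (0ℤ , 0ℤ) w) ≡ (+ n , 0ℤ)
    neverBelow : All (λ p → 0ℤ ℤ.≤ proj₂ p) (points (0ℤ , 0ℤ) w)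

-- Motzkin paths of length n, compared as words only.
ℳ : ℕ → Setoid Level.zero Level.zero
ℳ n = On.setoid {B = Σ (Vec Step n) IsMotzkin} (setoid (Vec Step n)) proj₁

{-# OPTIONS --safe #-}
module Submission where

-- The height of the path after i steps is the i-th distance, with distance 0
-- prepended and appended for the subspaces 0 and K^n.  Each F_i is a hyperplane
-- of F_(i+1), hence the kernel of a functional on it, so dim (F_i ∩ F′_i) grows
-- by at most 2 with i; it does not decrease.  Therefore i − dim (F_i ∩ F′_i)
-- changes by at most 1, and a word is determined by its heights.
--
-- Conversely, a Motzkin word is realized by two flags of coordinate subspaces:
-- an up step adds a new basis vector to each flag, a different one for the two;
-- a flat step adds the same new vector to both; a down step adds to each flag a
-- vector that only the other one has so far.

open import Defs
open import Level using (Level; _⊔_; Lift; lift; lower)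
open import Algebra.Apartness.Bundles using (HeytingField; HeytingCommutativeRing)
import Algebra.Bundles
open import Data.Bool.Base using (Bool; true; false; _∧_)
open import Data.Bool.Properties using (∧-zeroʳ)
open import Data.Fin.Base using (Fin; zero; suc; toℕ; fromℕ<)
import Data.Fin.Properties as Fin
open import Data.Fin.Subset using (Subset; inside; outside; ∣_∣; _∩_; ⊤; ⊥)
open import Data.Fin.Subset.Properties using (∣⊥∣≡0; ∣⊤∣≡n)
open import Data.Integer.Base as ℤ using (ℤ; +_; 0ℤ)
import Data.Integer.Properties as ℤ
open import Data.List.Base using (List; []; _∷_; length)
open import Data.Nat.Base as ℕ using (ℕ; zero; suc; _≥_; _∸_; s≤s; z≤n)
import Data.Nat.Properties as ℕ
open import Data.Nat.Solver using (module +-*-Solver)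
open import Data.Product.Base using (∃; _×_; _,_; proj₁; proj₂)
open import Data.Vec.Base as Vec using (Vec; []; _∷_; lookup)
open import Data.Vec.Functional as Vector using (Vector)
import Data.Vec.Functional.Relation.Binary.Equality.Setoid as VectorEquality
import Data.Vec.Properties as Vec
open import Data.Vec.Relation.Unary.All as All using (All; []; _∷_)
open import Function.Base using (_∘_)
open import Function.Bundles using (Bijection; Inverse)
open import Relation.Binary.Bundles using (Setoid)
open import Relation.Binary.PropositionalEquality as ≡ using (_≡_)
open import Relation.Nullary using (¬_; Dec; yes; no; contradiction)
open import Relation.Nullary.Decidable using (map′; decidable-stable)
open import Relation.Unary using (_⊆_)

open +-*-Solver using (solve; _:+_; _:=_)

-- Motzkin paths encoded by their heights.

data Adjacent : ℕ → ℕ → Set where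
  up   : ∀ {h} → Adjacent h (suc h)
  down : ∀ {h} → Adjacent (suc h) h
  flat : ∀ {h} → Adjacent h h

infixr 5 _∷_

-- Indexed by the starting height and the number of steps. Heights are natural numbers and the empty
-- path sits at height 0, so both Motzkin conditions hold by construction.
data Path : ℕ → ℕ → Set where
  []  : Path 0 0
  _∷_ : ∀ {h h′ m} → Adjacent h h′ → Path h′ m → Path h (suc m)

private
  variable
    h h′ h″ k m n : ℕ

-- Total in the index, with the value 0 past the end, so that no bounds have to be carried along.
height : Path h m → ℕ → ℕ
height {h} P       zero    = h
height     []      (suc i) = 0
height     (a ∷ P) (suc i) = height P i

toStep : Adjacent h h′ → Step
toStep up   = U
toStep down = D
toStep flat = H

word : Path h m → Vec Step m
word []      = []
word (a ∷ P) = toStep a ∷ word P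

height-beyond : (P : Path h m) {i : ℕ} → m ℕ.≤ i → height P i ≡ 0
height-beyond []      {zero}  _         = ≡.refl
height-beyond []      {suc i} _         = ≡.refl
height-beyond (a ∷ P) {suc i} (s≤s m≤i) = height-beyond P m≤i

Adjacent-irrelevant : (a a′ : Adjacent h h′) → a ≡ a′
Adjacent-irrelevant up   up   = ≡.refl
Adjacent-irrelevant down down = ≡.refl
Adjacent-irrelevant flat flat = ≡.refl

toStep-target : (a : Adjacent h h′) (a′ : Adjacent h h″) → toStep a ≡ toStep a′ → h′ ≡ h″
toStep-target up   up   _  = ≡.refl
toStep-target up   down ()
toStep-target up   flat ()
toStep-target down up   ()
toStep-target down down _  = ≡.refl
toStep-target down flat ()
toStep-target flat up   ()
toStep-target flat down ()
toStep-target flat flat _  = ≡.refl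

height-injective : (P P′ : Path h m) → (∀ i → height P i ≡ height P′ i) → P ≡ P′
height-injective []      []        _  = ≡.refl
-- The height at index 1 is where the tails start; once these agree, the first steps have the same
-- type and so are equal.
height-injective (a ∷ P) (a′ ∷ P′) eq with eq 1
... | ≡.refl = ≡.cong₂ _∷_ (Adjacent-irrelevant a a′) (height-injective P P′ (eq ∘ suc))

word-injective : (P P′ : Path h m) → word P ≡ word P′ → P ≡ P′
word-injective []      []        _  = ≡.refl
word-injective (a ∷ P) (a′ ∷ P′) eq
  with toStep-target a a′ (Vec.∷-injectiveˡ eq)
... | ≡.refl = ≡.cong₂ _∷_ (Adjacent-irrelevant a a′) (word-injective P P′ (Vec.∷-injectiveʳ eq))

⊹-toStep : (k : ℕ) (a : Adjacent h h′) →
  (+ k , + h) ⊹ displacement (toStep a) ≡ (+ suc k , + h′)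
⊹-toStep {h} k up   = ≡.cong₂ (λ x y → + x , + y) (ℕ.+-comm k 1) (ℕ.+-comm h 1)
⊹-toStep {_} {h} k down = ≡.cong (λ x → + x , + h) (ℕ.+-comm k 1)
⊹-toStep {h} k flat = ≡.cong₂ (λ x y → + x , + y) (ℕ.+-comm k 1) (ℕ.+-identityʳ h)

word-endpoint : (k : ℕ) (P : Path h m) →
  Vec.last (points (+ k , + h) (word P)) ≡ (+ (k ℕ.+ m) , 0ℤ)
word-endpoint k [] = ≡.cong (λ x → + x , 0ℤ) (≡.sym (ℕ.+-identityʳ k))
word-endpoint {m = suc m} k (a ∷ P) rewrite ⊹-toStep k a | ℕ.+-suc k m = word-endpoint (suc k) P

word-neverBelow : (k : ℕ) (P : Path h m) →
  All (λ p → 0ℤ ℤ.≤ proj₂ p) (points (+ k , + h) (word P))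
word-neverBelow k []      = ℤ.+≤+ z≤n ∷ []
word-neverBelow k (a ∷ P) rewrite ⊹-toStep k a = ℤ.+≤+ z≤n ∷ word-neverBelow (suc k) P

word-isMotzkin : (P : Path 0 m) → IsMotzkin (word P)
word-isMotzkin P = record { endpoint = word-endpoint 0 P ; neverBelow = word-neverBelow 0 P }

points-head : ∀ {ℓ} {Q : ℤ × ℤ → Set ℓ} (p : ℤ × ℤ) (w : Vec Step m) → All Q (points p w) → Q p
points-head p []      (q ∷ _) = q
points-head p (s ∷ w) (q ∷ _) = q

-- Induction on the word from an arbitrary starting height. A down step from height 0 is excluded
-- because its end, which is among the points visited, has ordinate -1.
word-surjective : (w : Vec Step m) (x : ℤ) →
  All (λ p → 0ℤ ℤ.≤ proj₂ p) (points (x , + h) w) →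
  proj₂ (Vec.last (points (x , + h) w)) ≡ 0ℤ → ∃ λ (P : Path h m) → word P ≡ w
word-surjective {h = zero} [] x _ _ = [] , ≡.refl
word-surjective {h = h} (U ∷ w) x (_ ∷ below) end rewrite ℕ.+-comm h 1 =
  let P , eq = word-surjective w _ below end in up ∷ P , ≡.cong (U ∷_) eq
word-surjective {h = zero} (D ∷ w) x (_ ∷ below) end =
  contradiction (points-head _ w below) λ ()
word-surjective {h = suc h} (D ∷ w) x (_ ∷ below) end =
  let P , eq = word-surjective w _ below end in down ∷ P , ≡.cong (D ∷_) eq
word-surjective {h = h} (H ∷ w) x (_ ∷ below) end rewrite ℕ.+-identityʳ h =
  let P , eq = word-surjective w _ below end in flat ∷ P , ≡.cong (H ∷_) eq

pathThrough : (g : ℕ → ℕ) (m : ℕ) → (∀ i → i ℕ.< m → Adjacent (g i) (g (suc i))) → g m ≡ 0 →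
  ∃ λ (P : Path (g 0) m) → ∀ i → i ℕ.≤ m → height P i ≡ g i
pathThrough g zero    adj g₀≡0 = empty g₀≡0 , λ { zero _ → ≡.refl }
  where
  empty : h ≡ 0 → Path h 0
  empty ≡.refl = []
pathThrough g (suc m) adj end =
  let P , eq = pathThrough (g ∘ suc) m (λ i i<m → adj (suc i) (s≤s i<m)) end in
  adj 0 (s≤s z≤n) ∷ P , λ { zero _ → ≡.refl ; (suc i) (s≤s i≤m) → eq i i≤m }

-- Here `a` and `b` stand for the dimensions of consecutive intersections: growth by 0, 1 or 2 is an
-- up, flat or down step. The first two bounds make the truncated subtractions exact.
∸-adjacent : ∀ {i a b} → a ℕ.≤ i → b ℕ.≤ suc i → a ℕ.≤ b → b ℕ.≤ 2 ℕ.+ a →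
  Adjacent (i ∸ a) (suc i ∸ b)
∸-adjacent {i} {zero} {zero} _ _ _ _ = up
∸-adjacent {i} {zero} {suc zero} _ _ _ _ = flat
∸-adjacent {suc i} {zero} {suc (suc zero)} _ _ _ _ = down
∸-adjacent {zero} {zero} {suc (suc b)} _ (s≤s ()) _ _
∸-adjacent {suc i} {zero} {suc (suc (suc b))} _ _ _ (s≤s (s≤s ()))
∸-adjacent {suc i} {suc a} {suc b} (s≤s p) (s≤s q) (s≤s r) (s≤s t) = ∸-adjacent p q r t

-- Basis vectors assigned to the steps of a path.

-- A pair (s , t) stands for a basis vector that is put into the first flag at
-- step s and into the second one at step t.  An up step at time t leaves t
-- pending; a down step exchanges its time with the latest pending one.
entries : Path h m → Vec ℕ h → ℕ → List (ℕ × ℕ)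
entries []         []            t = []
entries (up   ∷ P) pending       t = entries P (t ∷ pending) (suc t)
entries (down ∷ P) (p ∷ pending) t = (p , t) ∷ (t , p) ∷ entries P pending (suc t)
entries (flat ∷ P) pending       t = (t , t) ∷ entries P pending (suc t)

-- An up step makes no entry but one more pending time, a down step makes two and uses up one, a
-- flat step makes one. With nothing pending at the start, the entries thus index the coordinates of
-- K^n.
length-entries : (P : Path h m) (pending : Vec ℕ h) (t : ℕ) →
  length (entries P pending t) ≡ h ℕ.+ m
length-entries []         []            t = ≡.refl
length-entries {h} {suc m} (up ∷ P) pending t =
  ≡.trans (length-entries P (t ∷ pending) (suc t)) (≡.sym (ℕ.+-suc h m))
length-entries {suc h} {suc m} (down ∷ P) (p ∷ pending) t = ≡.cong suc
  (≡.trans (≡.cong suc (length-entries P pending (suc t))) (≡.sym (ℕ.+-suc h m)))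
length-entries {h} {suc m} (flat ∷ P) pending t =
  ≡.trans (≡.cong suc (length-entries P pending (suc t))) (≡.sym (ℕ.+-suc h m))

-- Counting entries by time.

before : ℕ → Vec ℕ m → Subset m
before i = Vec.map (ℕ._<ᵇ i)

tally : Bool → ℕ
tally true  = 1
tally false = 0

∣∷∣ : (b : Bool) (S : Subset m) → ∣ b ∷ S ∣ ≡ tally b ℕ.+ ∣ S ∣
∣∷∣ true  S = ≡.refl
∣∷∣ false S = ≡.refl

<⇒<ᵇ≡true : ∀ {a b} → a ℕ.< b → (a ℕ.<ᵇ b) ≡ true
<⇒<ᵇ≡true {zero}  {suc b} _         = ≡.refl
<⇒<ᵇ≡true {suc a} {suc b} (s≤s a<b) = <⇒<ᵇ≡true a<b

≥⇒<ᵇ≡false : ∀ {a b} → b ℕ.≤ a → (a ℕ.<ᵇ b) ≡ false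
≥⇒<ᵇ≡false {a}     {zero}  _         = ≡.refl
≥⇒<ᵇ≡false {suc a} {suc b} (s≤s b≤a) = ≥⇒<ᵇ≡false b≤a

<ᵇ≡false⇒≥ : ∀ {a b} → (a ℕ.<ᵇ b) ≡ false → b ℕ.≤ a
<ᵇ≡false⇒≥ {a}     {zero}  _  = z≤n
<ᵇ≡false⇒≥ {zero}  {suc b} ()
<ᵇ≡false⇒≥ {suc a} {suc b} eq = s≤s (<ᵇ≡false⇒≥ eq)

-- The counterpart of `before` for the steps still to come, at the times t, ..., t + m - 1.
countTimes : ℕ → ℕ → ℕ → ℕ
countTimes i t zero    = 0
countTimes i t (suc m) = tally (t ℕ.<ᵇ i) ℕ.+ countTimes i (suc t) m

countTimes-late : ∀ {i t} m → i ℕ.≤ t → countTimes i t m ≡ 0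
countTimes-late zero    i≤t = ≡.refl
countTimes-late (suc m) i≤t rewrite ≥⇒<ᵇ≡false i≤t = countTimes-late m (ℕ.m≤n⇒m≤1+n i≤t)

countTimes-≡ : ∀ t k → k ℕ.≤ m → countTimes (t ℕ.+ k) t m ≡ k
countTimes-≡ {m} t zero _ = countTimes-late m (ℕ.≤-reflexive (ℕ.+-identityʳ t))
countTimes-≡ {suc m} t (suc k) (s≤s k≤m)
  rewrite <⇒<ᵇ≡true (ℕ.m<m+n t {suc k} (s≤s z≤n)) | ℕ.+-suc t k =
  ≡.cong suc (countTimes-≡ (suc t) k k≤m)

-- The coordinates of the i-th subspace of each flag. Times start at 0, so those less than `i`
-- belong to the first `i` steps.
firstBy secondBy : ℕ → (L : List (ℕ × ℕ)) → Subset (length L)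
firstBy  i L = Vec.map (λ e → proj₁ e ℕ.<ᵇ i) (Vec.fromList L)
secondBy i L = Vec.map (λ e → proj₂ e ℕ.<ᵇ i) (Vec.fromList L)

module _ (i : ℕ) where
  private
    τ : ℕ → ℕ
    τ t = tally (t ℕ.<ᵇ i)

  -- Every pending and every future time is the first component of exactly one
  -- entry, and the second component of exactly one.
  ∣firstBy∣ : (P : Path h m) (pending : Vec ℕ h) (t : ℕ) →
    ∣ firstBy i (entries P pending t) ∣ ≡ ∣ before i pending ∣ ℕ.+ countTimes i t m
  ∣firstBy∣ [] [] t = ≡.refl
  ∣firstBy∣ {m = suc m} (up ∷ P) ps t
    rewrite ∣firstBy∣ P (t ∷ ps) (suc t) | ∣∷∣ (t ℕ.<ᵇ i) (before i ps) =
    solve 3 (λ a b c → (a :+ b) :+ c := b :+ (a :+ c)) ≡.refl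
      (τ t) ∣ before i ps ∣ (countTimes i (suc t) m)
  ∣firstBy∣ {m = suc m} (down ∷ P) (p ∷ ps) t
    rewrite ∣∷∣ (p ℕ.<ᵇ i) ((t ℕ.<ᵇ i) ∷ firstBy i (entries P ps (suc t)))
          | ∣∷∣ (t ℕ.<ᵇ i) (firstBy i (entries P ps (suc t)))
          | ∣firstBy∣ P ps (suc t) | ∣∷∣ (p ℕ.<ᵇ i) (before i ps) =
    solve 4 (λ a b c d → a :+ (b :+ (c :+ d)) := (a :+ c) :+ (b :+ d)) ≡.refl
      (τ p) (τ t) ∣ before i ps ∣ (countTimes i (suc t) m)
  ∣firstBy∣ {m = suc m} (flat ∷ P) ps t
    rewrite ∣∷∣ (t ℕ.<ᵇ i) (firstBy i (entries P ps (suc t))) | ∣firstBy∣ P ps (suc t) =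
    solve 3 (λ a b c → a :+ (b :+ c) := b :+ (a :+ c)) ≡.refl
      (τ t) ∣ before i ps ∣ (countTimes i (suc t) m)

  ∣secondBy∣ : (P : Path h m) (pending : Vec ℕ h) (t : ℕ) →
    ∣ secondBy i (entries P pending t) ∣ ≡ ∣ before i pending ∣ ℕ.+ countTimes i t m
  ∣secondBy∣ [] [] t = ≡.refl
  ∣secondBy∣ {m = suc m} (up ∷ P) ps t
    rewrite ∣secondBy∣ P (t ∷ ps) (suc t) | ∣∷∣ (t ℕ.<ᵇ i) (before i ps) =
    solve 3 (λ a b c → (a :+ b) :+ c := b :+ (a :+ c)) ≡.refl
      (τ t) ∣ before i ps ∣ (countTimes i (suc t) m)
  ∣secondBy∣ {m = suc m} (down ∷ P) (p ∷ ps) t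
    rewrite ∣∷∣ (t ℕ.<ᵇ i) ((p ℕ.<ᵇ i) ∷ secondBy i (entries P ps (suc t)))
          | ∣∷∣ (p ℕ.<ᵇ i) (secondBy i (entries P ps (suc t)))
          | ∣secondBy∣ P ps (suc t) | ∣∷∣ (p ℕ.<ᵇ i) (before i ps) =
    solve 4 (λ a b c d → b :+ (a :+ (c :+ d)) := (a :+ c) :+ (b :+ d)) ≡.refl
      (τ p) (τ t) ∣ before i ps ∣ (countTimes i (suc t) m)
  ∣secondBy∣ {m = suc m} (flat ∷ P) ps t
    rewrite ∣∷∣ (t ℕ.<ᵇ i) (secondBy i (entries P ps (suc t))) | ∣secondBy∣ P ps (suc t) =
    solve 3 (λ a b c → a :+ (b :+ c) := b :+ (a :+ c)) ≡.refl
      (τ t) ∣ before i ps ∣ (countTimes i (suc t) m)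

bothBy : ℕ → (L : List (ℕ × ℕ)) → Subset (length L)
bothBy i L = firstBy i L ∩ secondBy i L

-- Every entry still to be made contains the time of the step that makes it, which is at least `t`.
∣bothBy∣-late : ∀ {i t} → i ℕ.≤ t → (P : Path h m) (pending : Vec ℕ h) →
  ∣ bothBy i (entries P pending t) ∣ ≡ 0
∣bothBy∣-late i≤t []         []            = ≡.refl
∣bothBy∣-late {t = t} i≤t (up ∷ P) ps = ∣bothBy∣-late (ℕ.m≤n⇒m≤1+n i≤t) P (t ∷ ps)
∣bothBy∣-late {i = i} i≤t (down ∷ P) (p ∷ ps)
  rewrite ≥⇒<ᵇ≡false i≤t | ∧-zeroʳ (p ℕ.<ᵇ i) = ∣bothBy∣-late (ℕ.m≤n⇒m≤1+n i≤t) P ps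
∣bothBy∣-late i≤t (flat ∷ P) ps
  rewrite ≥⇒<ᵇ≡false i≤t = ∣bothBy∣-late (ℕ.m≤n⇒m≤1+n i≤t) P ps

-- Moved to one side so that no subtraction occurs: the size is k + h − height P k,
-- a down step completing two entries, a flat step one and an up step none.
∣bothBy∣ : (P : Path h m) (pending : Vec ℕ h) (t k : ℕ) → All (ℕ._< t) pending → k ℕ.≤ m →
  ∣ bothBy (t ℕ.+ k) (entries P pending t) ∣ ℕ.+ height P k ≡ k ℕ.+ h
∣bothBy∣ {h} P ps t zero _ _
  rewrite ∣bothBy∣-late (ℕ.≤-reflexive (ℕ.+-identityʳ t)) P ps = ≡.refl
∣bothBy∣ {h} (up ∷ P) ps t (suc k) ps<t (s≤s k≤m) rewrite ℕ.+-suc t k =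
  ≡.trans (∣bothBy∣ P (t ∷ ps) (suc t) k (ℕ.≤-refl ∷ All.map ℕ.m≤n⇒m≤1+n ps<t) k≤m) (ℕ.+-suc k h)
∣bothBy∣ {suc h} (down ∷ P) (p ∷ ps) t (suc k) (p<t ∷ ps<t) (s≤s k≤m)
  rewrite <⇒<ᵇ≡true (ℕ.m<m+n t {suc k} (s≤s z≤n))
        | <⇒<ᵇ≡true (ℕ.<-trans p<t (ℕ.m<m+n t {suc k} (s≤s z≤n)))
        | ℕ.+-suc t k | ℕ.+-suc k h =
  ≡.cong (ℕ.suc ∘ ℕ.suc) (∣bothBy∣ P ps (suc t) k (All.map ℕ.m≤n⇒m≤1+n ps<t) k≤m)
∣bothBy∣ (flat ∷ P) ps t (suc k) ps<t (s≤s k≤m)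
  rewrite <⇒<ᵇ≡true (ℕ.m<m+n t {suc k} (s≤s z≤n)) | ℕ.+-suc t k =
  ≡.cong suc (∣bothBy∣ P ps (suc t) k (All.map ℕ.m≤n⇒m≤1+n ps<t) k≤m)

-- Chains of coordinate sets realizing a path.

-- Inclusion is put contrapositively, in terms of `outside`, because a coordinate subspace is given
-- by the coordinates that vanish on it.
record SubsetChain (n : ℕ) : Set where
  field
    subset   : ℕ → Subset n
    size     : ∀ {i} → i ℕ.≤ n → ∣ subset i ∣ ≡ i
    monotone : ∀ {i j} → i ℕ.≤ j → ∀ x → lookup (subset j) x ≡ outside → lookup (subset i) x ≡ outside

open SubsetChain using (subset)

map-<ᵇ-monotone : ∀ {i j n} {A : Set} (f : A → ℕ) (v : Vec A n) → i ℕ.≤ j → ∀ x →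
  lookup (Vec.map (λ e → f e ℕ.<ᵇ j) v) x ≡ outside →
  lookup (Vec.map (λ e → f e ℕ.<ᵇ i) v) x ≡ outside
map-<ᵇ-monotone f (e ∷ v) i≤j zero    eq = ≥⇒<ᵇ≡false (ℕ.≤-trans i≤j (<ᵇ≡false⇒≥ eq))
map-<ᵇ-monotone f (e ∷ v) i≤j (suc x) eq = map-<ᵇ-monotone f v i≤j x eq

subsetChains : ∀ {n} (P : Path 0 n) → ∃ λ (S : SubsetChain n) → ∃ λ (T : SubsetChain n) →
  ∀ {i} → i ℕ.≤ n → ∣ subset S i ∩ subset T i ∣ ℕ.+ height P i ≡ i
subsetChains {n} P = chains n (length-entries P [] 0)
  (λ i≤n → ≡.trans (∣firstBy∣ _ P [] 0) (countTimes-≡ 0 _ i≤n))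
  (λ i≤n → ≡.trans (∣secondBy∣ _ P [] 0) (countTimes-≡ 0 _ i≤n))
  (λ i≤n → ≡.trans (∣bothBy∣ P [] 0 _ [] i≤n) (ℕ.+-identityʳ _))
  where
  L = entries P [] 0
  -- The length of `L` is abstracted, so that matching on the equation turns subsets of its index
  -- set into subsets of `Fin n`.
  chains : ∀ n → length L ≡ n →
    (∀ {i} → i ℕ.≤ n → ∣ firstBy i L ∣ ≡ i) → (∀ {i} → i ℕ.≤ n → ∣ secondBy i L ∣ ≡ i) →
    (∀ {i} → i ℕ.≤ n → ∣ bothBy i L ∣ ℕ.+ height P i ≡ i) →
    ∃ λ (S : SubsetChain n) → ∃ λ (T : SubsetChain n) →
      ∀ {i} → i ℕ.≤ n → ∣ subset S i ∩ subset T i ∣ ℕ.+ height P i ≡ i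
  chains _ ≡.refl size₁ size₂ both =
    record { subset = λ i → firstBy i L ; size = size₁
           ; monotone = map-<ᵇ-monotone proj₁ (Vec.fromList L) } ,
    record { subset = λ i → secondBy i L ; size = size₂
           ; monotone = map-<ᵇ-monotone proj₂ (Vec.fromList L) } ,
    both


-- Linear algebra over a finite field: exhaustive search and inverses.

module FiniteLinearAlgebra {c ℓ₁ ℓ₂ : Level} (K : HeytingField c ℓ₁ ℓ₂)
                           (q : ℕ) (card : HasCardinality K q) where

  open HeytingField K hiding (setoid; zero)
  open LinearAlgebra K hiding (𝒟)
  open VectorEquality (HeytingField.setoid K)
  open Algebra.Bundles.CommutativeRing
    (HeytingCommutativeRing.commutativeRing heytingCommutativeRing)
    using (setoid; semiring; ring)
  open import Algebra.Properties.Semiring.Sum semiring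
  open import Algebra.Properties.Ring ring using (-‿distribˡ-*; -‿distribʳ-*; -0#≈0#; +-inverseˡ-unique)
  open import Relation.Binary.Reasoning.Setoid setoid

  private
    variable
      x : Carrier
    module card = Inverse card

  infix 4 _≟_ _≋?_

  _≟_ : (x y : Carrier) → Dec (x ≈ y)
  x ≟ y = map′ (λ eq → begin
      x                      ≈⟨ card.strictlyInverseʳ x ⟨
      card.from (card.to x)  ≈⟨ card.from-cong eq ⟩
      card.from (card.to y)  ≈⟨ card.strictlyInverseʳ y ⟩
      y                      ∎) card.to-cong (card.to x Fin.≟ card.to y)

  _≋?_ : (u v : Vector Carrier n) → Dec (u ≋ v)
  u ≋? v = Fin.all? (λ j → u j ≟ v j)

  any? : ∀ {p} {P : Carrier → Set p} → (∀ {x y} → x ≈ y → P x → P y) →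
         (∀ x → Dec (P x)) → Dec (∃ P)
  any? P-resp P? = map′ (λ (i , p) → card.from i , p)
    (λ (x , p) → card.to x , P-resp (sym (card.strictlyInverseʳ x)) p)
    (Fin.any? (P? ∘ card.from))

  anyVector? : ∀ {p} (k : ℕ) {P : Vector Carrier k → Set p} →
               (∀ {u v} → u ≋ v → P u → P v) →
               (∀ u → Dec (P u)) → Dec (∃ P)
  anyVector? zero    P-resp P? =
    map′ (_ ,_) (λ (_ , p) → P-resp (λ ()) p) (P? Vector.[])
  anyVector? (suc k) P-resp P? =
    map′ (λ (a , u , p) → a Vector.∷ u , p)
         (λ (u , p) → Vector.head u , Vector.tail u ,
            P-resp (λ { zero → refl ; (suc _) → refl }) p)
         (any? (λ a≈b (u , p) → u , P-resp (λ { zero → a≈b ; (suc _) → refl }) p)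
           λ a → anyVector? k
             (λ u≋v → P-resp λ { zero → refl ; (suc i) → u≋v i }) λ u → P? _)

  1≉0 : ¬ 1# ≈ 0#
  1≉0 1≈0 = #-irrefl refl (invertible⇒# {0#} {0#}
    (0# , trans (zeroˡ _) (sym 1≈0) , trans (zeroʳ _) (sym 1≈0)))

  -- Non-equality only refutes the negation of apartness; searching the finite
  -- carrier for an inverse removes the double negation.
  inverse : ¬ x ≈ 0# → ∃ λ y → y * x ≈ 1#
  inverse {x} x≉0 = decidable-stable
    (any? (λ y≈z yx≈1 → trans (*-cong (sym y≈z) refl) yx≈1) (λ y → y * x ≟ 1#))
    λ ∄y → x≉0 (proj₁ (tight x 0#) λ x#0 →
      let y , y[x-0]≈1 , _ = #⇒invertible x#0 in
      ∄y (y , trans (*-cong refl (sym x-0≈x)) y[x-0]≈1))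
    where
    x-0≈x : x - 0# ≈ x
    x-0≈x = trans (+-cong refl -0#≈0#) (+-identityʳ x)

  -- Linear combinations.

  sum-zero : ∀ {k} {f : Vector Carrier k} → (∀ i → f i ≈ 0#) → sum f ≈ 0#
  sum-zero {k} f≈0 = trans (sum-cong-≋ f≈0) (sum-replicate-zero k)

  sum-zeroˡ : (f : Vector Carrier k) → sum (λ i → 0# * f i) ≈ 0#
  sum-zeroˡ f = sum-zero (λ i → zeroˡ (f i))

  sum-zeroʳ : (f : Vector Carrier k) → sum (λ i → f i * 0#) ≈ 0#
  sum-zeroʳ f = sum-zero (λ i → zeroʳ (f i))

  linearCombination-cong : {a a′ : Vector Carrier k} (b : Vector (Vector Carrier n) k) →
    a ≋ a′ → linearCombination a b ≋ linearCombination a′ b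
  linearCombination-cong b a≋a′ j = sum-cong-≋ (λ i → *-cong (a≋a′ i) refl)

  linearCombination-congʳ : (a : Vector Carrier k) {b b′ : Vector (Vector Carrier n) k} →
    (∀ i → b i ≋ b′ i) → linearCombination a b ≋ linearCombination a b′
  linearCombination-congʳ a b≋b′ j = sum-cong-≋ (λ i → *-cong refl (b≋b′ i j))

  linearCombination-zero : {a : Vector Carrier k} (b : Vector (Vector Carrier n) k) →
    a ≋ 0ᵛ → linearCombination a b ≋ 0ᵛ
  linearCombination-zero b a≋0 j = sum-zero (λ i → trans (*-cong (a≋0 i) refl) (zeroˡ _))

  -- Associativity of the matrix product a A b with `a` a row vector, by interchanging the two sums.
  linearCombination-assoc :
    (a : Vector Carrier m) (A : Vector (Vector Carrier k) m) (b : Vector (Vector Carrier n) k) →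
    linearCombination a (λ i → linearCombination (A i) b) ≋
    linearCombination (linearCombination a A) b
  linearCombination-assoc a A b j = begin
    sum (λ i → a i * sum (λ l → A i l * b l j))
      ≈⟨ sum-cong-≋ (λ i → *-distribˡ-sum (a i) (λ l → A i l * b l j)) ⟩
    sum (λ i → sum (λ l → a i * (A i l * b l j)))
      ≈⟨ ∑-comm (λ i l → a i * (A i l * b l j)) ⟩
    sum (λ l → sum (λ i → a i * (A i l * b l j)))
      ≈⟨ sum-cong-≋ (λ l → sum-cong-≋ (λ i → *-assoc (a i) (A i l) (b l j))) ⟨
    sum (λ l → sum (λ i → a i * A i l * b l j))
      ≈⟨ sum-cong-≋ (λ l → *-distribʳ-sum (b l j) (λ i → a i * A i l)) ⟨
    sum (λ l → sum (λ i → a i * A i l) * b l j)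
      ∎

  linearCombination-closed : (W : Subspace n) (a : Vector Carrier k)
    {b : Vector (Vector Carrier n) k} → (∀ i → member W (b i)) →
    member W (linearCombination a b)
  linearCombination-closed {k = zero}  W a b∈W = Subspace.0-closed W
  linearCombination-closed {k = suc k} W a b∈W =
    Subspace.+-closed W (Subspace.·-closed W (a zero) (b∈W zero))
      (linearCombination-closed W (a ∘ suc) (b∈W ∘ suc))

  -- Independent families and kernels of functionals.

  unit : Fin k → Vector Carrier k
  unit zero    = 1# Vector.∷ 0ᵛ
  unit (suc i) = 0# Vector.∷ unit i

  linearCombination-unit : (a : Vector Carrier k) → linearCombination a unit ≋ a
  linearCombination-unit a zero = trans
    (+-cong (*-identityʳ (a zero)) (sum-zeroʳ (a ∘ suc))) (+-identityʳ (a zero))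
  linearCombination-unit a (suc j) =
    trans (+-cong (zeroʳ (a zero)) (linearCombination-unit (a ∘ suc) j)) (+-identityˡ _)

  linearCombination-unit-at : (i : Fin k) (b : Vector (Vector Carrier n) k) →
    linearCombination (unit i) b ≋ b i
  linearCombination-unit-at zero    b j = trans
    (+-cong (*-identityˡ _) (sum-zeroˡ λ i → b (suc i) j)) (+-identityʳ _)
  linearCombination-unit-at (suc i) b j =
    trans (+-cong (zeroˡ _) (linearCombination-unit-at i (b ∘ suc) j)) (+-identityˡ _)

  unit-independent : LinearlyIndependent (unit {n})
  unit-independent a a∙e≋0 i = trans (sym (linearCombination-unit a i)) (a∙e≋0 i)

  -- The rows of the block diagonal matrix with blocks 1 and `u`.
  adjoinUnit : Vector (Vector Carrier n) m → Vector (Vector Carrier (suc n)) (suc m)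
  adjoinUnit u = unit zero Vector.∷ λ i → 0# Vector.∷ u i

  adjoinUnit-head : (u : Vector (Vector Carrier n) m) (a : Vector Carrier (suc m)) →
    linearCombination a (adjoinUnit u) zero ≈ a zero
  adjoinUnit-head u a = trans
    (+-cong (*-identityʳ (a zero)) (sum-zeroʳ (a ∘ suc))) (+-identityʳ (a zero))

  adjoinUnit-tail : (u : Vector (Vector Carrier n) m) (a : Vector Carrier (suc m)) →
    linearCombination a (adjoinUnit u) ∘ suc ≋ linearCombination (a ∘ suc) u
  adjoinUnit-tail u a j = trans (+-cong (zeroʳ (a zero)) refl) (+-identityˡ _)

  adjoinUnit-independent : {u : Vector (Vector Carrier n) m} →
    LinearlyIndependent u → LinearlyIndependent (adjoinUnit u)
  adjoinUnit-independent {u = u} u-ind a a∙u≋0 zero    =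
    trans (sym (adjoinUnit-head u a)) (a∙u≋0 zero)
  adjoinUnit-independent {u = u} u-ind a a∙u≋0 (suc i) =
    u-ind (a ∘ suc) (λ j → trans (sym (adjoinUnit-tail u a j)) (a∙u≋0 (suc j))) i

  -- A relation `a` among the combinations is the relation a A among `b`; so a A vanishes, and then
  -- `a` does.
  independent-∘ : {A : Vector (Vector Carrier k) m} {b : Vector (Vector Carrier n) k} →
    LinearlyIndependent A → LinearlyIndependent b →
    LinearlyIndependent (λ i → linearCombination (A i) b)
  independent-∘ {A = A} {b} A-ind b-ind a eq =
    A-ind a (b-ind (linearCombination a A)
      λ j → trans (sym (linearCombination-assoc a A b j)) (eq j))

  -- If the first coefficient of φ vanishes, the first unit vector is in the kernel and the rest
  -- comes by recursion. Otherwise each later unit vector is corrected by a multiple of the first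
  -- one; the tails remain unit vectors, hence independent.
  kernel : (φ : Vector Carrier (suc m)) →
    ∃ λ (A : Vector (Vector Carrier (suc m)) m) →
      LinearlyIndependent A × (∀ i → sum (λ l → A i l * φ l) ≈ 0#)
  kernel {zero}  φ = (λ ()) , (λ _ _ ()) , λ ()
  kernel {suc m} φ with φ zero ≟ 0#
  ... | yes φ₀≈0 = adjoinUnit (proj₁ rec) , adjoinUnit-independent (proj₁ (proj₂ rec)) , λ where
        zero → trans (+-cong (trans (*-identityˡ _) φ₀≈0) (sum-zeroˡ (φ ∘ suc))) (+-identityˡ 0#)
        (suc i) → trans (+-cong (zeroˡ _) (proj₂ (proj₂ rec) i)) (+-identityˡ 0#)
    where
    rec = kernel (φ ∘ suc)
  ... | no φ₀≉0 = A , A-ind , A-kills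
    where
    φ₀⁻¹ = proj₁ (inverse φ₀≉0)
    A : Vector (Vector Carrier (suc (suc m))) (suc m)
    A i = - (φ (suc i) * φ₀⁻¹) Vector.∷ unit i
    A-ind : LinearlyIndependent A
    A-ind a eq = unit-independent a (eq ∘ suc)
    A-kills : ∀ i → sum (λ l → A i l * φ l) ≈ 0#
    A-kills i = begin
      - (φ (suc i) * φ₀⁻¹) * φ zero + sum (λ l → unit i l * φ (suc l))
        -- The tail of φ is read as a family of vectors of length 1, to make the sum a linear
        -- combination.
        ≈⟨ +-cong (sym (-‿distribˡ-* _ _)) (linearCombination-unit-at i (λ l (_ : Fin 1) → φ (suc l)) zero) ⟩
      - (φ (suc i) * φ₀⁻¹ * φ zero) + φ (suc i)
        ≈⟨ +-cong (-‿cong (trans (*-assoc _ _ _) (trans (*-cong refl (proj₂ (inverse φ₀≉0))) (*-identityʳ _)))) refl ⟩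
      - φ (suc i) + φ (suc i)
        ≈⟨ -‿inverseˡ _ ⟩
      0# ∎

  independent⇒≤ : {u : Vector (Vector Carrier n) m} → LinearlyIndependent u → m ℕ.≤ n
  independent⇒≤ {m = zero} _ = z≤n
  independent⇒≤ {zero} {suc m} u-ind = contradiction (u-ind (λ _ → 1#) (λ ()) zero) 1≉0
  independent⇒≤ {suc n} {suc m} {u} u-ind =
    let A , A-ind , A-kills = kernel (λ l → u l zero) in
    s≤s (independent⇒≤ {u = λ i → linearCombination (A i) u ∘ suc} λ a eq →
      independent-∘ {A = A} {b = u} A-ind u-ind a λ where
        zero    → sum-zero {f = λ i → a i * _} (λ i → trans (*-cong refl (A-kills i)) (zeroʳ (a i)))
        (suc j) → eq j)

  -- Spans, exchange and dimension.

  Span : Vector (Vector Carrier n) k → Vector Carrier n → Set (c ⊔ ℓ₁)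
  Span b x = ∃ λ a → x ≋ linearCombination a b

  -- The coefficient vectors of `u` over `b` are independent in K^k, since a relation among them is
  -- one among `u`.
  steinitz : {u : Vector (Vector Carrier n) m} {b : Vector (Vector Carrier n) k} →
    LinearlyIndependent u → (∀ i → Span b (u i)) → m ℕ.≤ k
  steinitz {u = u} {b} u-ind u∈b = independent⇒≤ {u = proj₁ ∘ u∈b} λ a eq →
    u-ind a λ j → begin
      linearCombination a u j
        ≈⟨ linearCombination-congʳ a (λ i → proj₂ (u∈b i)) j ⟩
      linearCombination a (λ i → linearCombination (proj₁ (u∈b i)) b) j
        ≈⟨ linearCombination-assoc a (proj₁ ∘ u∈b) b j ⟩
      linearCombination (linearCombination a (proj₁ ∘ u∈b)) b j
        ≈⟨ linearCombination-zero b eq j ⟩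
      0# ∎

  -- There are finitely many coefficient vectors to try. This decision is what later permits arguing
  -- by contradiction about spans.
  span? : (b : Vector (Vector Carrier n) k) (x : Vector Carrier n) → Dec (Span b x)
  span? {k = k} b x = anyVector? k
    (λ a≋a′ eq j → trans (eq j) (linearCombination-cong b a≋a′ j))
    (λ a → x ≋? linearCombination a b)

  -- In a relation where `x` has a nonzero coefficient, dividing by it would put `x` into the span
  -- of `b`.
  ∷-independent : {x : Vector Carrier n} {b : Vector (Vector Carrier n) k} →
    LinearlyIndependent b → ¬ Span b x → LinearlyIndependent (x Vector.∷ b)
  ∷-independent {x = x} {b} b-ind x∉b a eq with a zero ≟ 0#
  ... | yes a₀≈0 = λ where
    zero    → a₀≈0
    (suc i) → b-ind (a ∘ suc) (λ j → begin
      linearCombination (a ∘ suc) b j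
        ≈⟨ +-identityˡ _ ⟨
      0# + linearCombination (a ∘ suc) b j
        ≈⟨ +-cong (trans (*-cong a₀≈0 refl) (zeroˡ (x j))) refl ⟨
      a zero * x j + linearCombination (a ∘ suc) b j
        ≈⟨ eq j ⟩
      0# ∎) i
  ... | no a₀≉0 = contradiction ((λ i → - a₀⁻¹ * a (suc i)) , x≋) x∉b
    where
    a₀⁻¹ = proj₁ (inverse a₀≉0)
    x≋ : x ≋ linearCombination (λ i → - a₀⁻¹ * a (suc i)) b
    x≋ j = begin
      x j
        ≈⟨ *-identityˡ (x j) ⟨
      1# * x j
        ≈⟨ *-cong (proj₂ (inverse a₀≉0)) refl ⟨
      a₀⁻¹ * a zero * x j
        ≈⟨ *-assoc _ _ _ ⟩
      a₀⁻¹ * (a zero * x j)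
        ≈⟨ *-cong refl (+-inverseˡ-unique _ _ (eq j)) ⟩
      a₀⁻¹ * - linearCombination (a ∘ suc) b j
        ≈⟨ trans (sym (-‿distribʳ-* _ _)) (-‿distribˡ-* _ _) ⟩
      - a₀⁻¹ * linearCombination (a ∘ suc) b j
        ≈⟨ *-distribˡ-sum (- a₀⁻¹) (λ i → a (suc i) * b i j) ⟩
      sum (λ i → - a₀⁻¹ * (a (suc i) * b i j))
        ≈⟨ sum-cong-≋ (λ i → *-assoc (- a₀⁻¹) (a (suc i)) (b i j)) ⟨
      sum (λ i → - a₀⁻¹ * a (suc i) * b i j)
        ∎

  independent⇒≤dimension : {W : Subspace n} {u : Vector (Vector Carrier n) m} →
    LinearlyIndependent u → (∀ i → member W (u i)) → HasDimension W k → m ℕ.≤ k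
  independent⇒≤dimension u-ind u∈W (b , b-basis) =
    steinitz u-ind (λ i → IsBasis.spanning b-basis (u∈W i))

  dimension-mono : {V W : Subspace n} → member V ⊆ member W →
    HasDimension V m → HasDimension W k → m ℕ.≤ k
  dimension-mono {V = V} {W} V⊆W (b , b-basis) =
    independent⇒≤dimension {W = W} b.independent (λ i → V⊆W (b.inside i))
    where module b = IsBasis b-basis

  dimension-unique : {V : Subspace n} → HasDimension V m → HasDimension V k → m ≡ k
  dimension-unique {V = V} d d′ = ℕ.≤-antisym
    (dimension-mono {V = V} {V} (λ v → v) d d′) (dimension-mono {V = V} {V} (λ v → v) d′ d)

  dimension-resp : {V W : Subspace n} → member V ⊆ member W → member W ⊆ member V →
    HasDimension V k → HasDimension W k
  dimension-resp V⊆W W⊆V (b , b-basis) = b , record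
    { inside      = λ i → V⊆W (b.inside i)
    ; independent = b.independent
    ; spanning    = λ x∈W → b.spanning (W⊆V x∈W)
    }
    where module b = IsBasis b-basis

  -- A vector of `W` outside the span could be adjoined, giving k + 1 independent vectors in
  -- dimension k.
  independent⇒spanning : {W : Subspace n} {u : Vector (Vector Carrier n) k} →
    HasDimension W k → LinearlyIndependent u → (∀ i → member W (u i)) →
    ∀ {x} → member W x → Span u x
  independent⇒spanning {W = W} {u} dim u-ind u∈W {x} x∈W = decidable-stable (span? u x) λ x∉u →
    ℕ.1+n≰n (independent⇒≤dimension {W = W} {u = x Vector.∷ u} (∷-independent u-ind x∉u)
      (λ { zero → x∈W ; (suc i) → u∈W i }) dim)

  -- By exchange, not all k + 1 basis vectors of `W` lie in the span of k vectors; a finite search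
  -- finds one that does not.
  ∃-outside : {W : Subspace n} → HasDimension W (suc k) →
    (b : Vector (Vector Carrier n) k) → ∃ λ w → member W w × ¬ Span b w
  ∃-outside {k = k} (c , c-basis) b =
    let i , cᵢ∉b = Fin.¬∀⟶∃¬ (suc k) (λ i → Span b (c i)) (λ i → span? b (c i))
                     (λ c∈b → ℕ.1+n≰n (steinitz c.independent c∈b))
    in c i , c.inside i , cᵢ∉b
    where module c = IsBasis c-basis

  -- A hyperplane V of W is the kernel of a functional on W, namely the
  -- coordinate along a vector w outside V.
  independent-∩ : {V W X : Subspace n} → member V ⊆ member W → member X ⊆ member W →
    HasDimension V k → HasDimension W (suc k) →
    {u : Vector (Vector Carrier n) (suc m)} → LinearlyIndependent u → (∀ i → member X (u i)) →
    ∃ λ (u′ : Vector (Vector Carrier n) m) →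
      LinearlyIndependent u′ × (∀ i → member (X ∩ˢ V) (u′ i))
  independent-∩ {n = n} {k} {m} {V} {W} {X} V⊆W X⊆W (b , b-basis) W-dim {u} u-ind u∈X =
    u′ , independent-∘ {A = A} {b = u} A-ind u-ind , λ i →
      linearCombination-closed X (A i) u∈X ,
      Subspace.resp V (λ j → sym (u′≋ i j)) (linearCombination-closed V (coords i ∘ suc) b.inside)
    where
    module b = IsBasis b-basis
    outside-V = ∃-outside {W = W} W-dim b
    w = proj₁ outside-V
    wb = w Vector.∷ b
    C : ∀ i → Span wb (u i)
    C i = independent⇒spanning {W = W} {u = wb} W-dim
      (∷-independent b.independent (proj₂ (proj₂ outside-V)))
      (λ { zero → proj₁ (proj₂ outside-V) ; (suc i) → V⊆W (b.inside i) }) (X⊆W (u∈X i))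
    ker = kernel (λ i → proj₁ (C i) zero)
    A = proj₁ ker
    A-ind = proj₁ (proj₂ ker)
    u′ : Vector (Vector Carrier n) m
    u′ i = linearCombination (A i) u
    coords : Fin m → Vector Carrier (suc k)
    coords i = linearCombination (A i) (proj₁ ∘ C)
    u′≋ : ∀ i → u′ i ≋ linearCombination (coords i ∘ suc) b
    u′≋ i j = begin
      linearCombination (A i) u j
        ≈⟨ linearCombination-congʳ (A i) (λ l → proj₂ (C l)) j ⟩
      linearCombination (A i) (λ l → linearCombination (proj₁ (C l)) wb) j
        ≈⟨ linearCombination-assoc (A i) (proj₁ ∘ C) wb j ⟩
      coords i zero * w j + linearCombination (coords i ∘ suc) b j
        ≈⟨ +-cong (trans (*-cong (proj₂ (proj₂ ker) i) refl) (zeroˡ (w j))) refl ⟩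
      0# + linearCombination (coords i ∘ suc) b j
        ≈⟨ +-identityˡ _ ⟩
      linearCombination (coords i ∘ suc) b j
        ∎

  -- Starting from a basis of W ∩ W′, cutting with the hyperplane V of W and then with the
  -- hyperplane V′ of W′ costs one independent vector each time.
  dimension-∩-step : {V W V′ W′ : Subspace n} {k′ m′ : ℕ} →
    member V ⊆ member W → member V′ ⊆ member W′ →
    HasDimension V k → HasDimension W (suc k) →
    HasDimension V′ k′ → HasDimension W′ (suc k′) →
    HasDimension (V ∩ˢ V′) m → HasDimension (W ∩ˢ W′) m′ → m′ ℕ.≤ 2 ℕ.+ m
  dimension-∩-step {m′ = zero}        V⊆W V′⊆W′ V-dim W-dim V′-dim W′-dim dim dim′ = z≤n
  dimension-∩-step {m′ = suc zero}    V⊆W V′⊆W′ V-dim W-dim V′-dim W′-dim dim dim′ = s≤s z≤n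
  dimension-∩-step {V = V} {W} {V′} {W′} {m′ = suc (suc m′)}
    V⊆W V′⊆W′ V-dim W-dim V′-dim W′-dim dim (b , b-basis) =
    s≤s (s≤s (independent⇒≤dimension {W = V ∩ˢ V′} {u = proj₁ v} (proj₁ (proj₂ v))
      (λ i → proj₂ (proj₁ (proj₂ (proj₂ v) i)) , proj₂ (proj₂ (proj₂ v) i)) dim))
    where
    module b = IsBasis b-basis
    u = independent-∩ {V = V} {W} {W ∩ˢ W′} V⊆W proj₁ V-dim W-dim {b} b.independent b.inside
    v = independent-∩ {V = V′} {W′} {(W ∩ˢ W′) ∩ˢ V} V′⊆W′ (proj₂ ∘ proj₁) V′-dim W′-dim
          {proj₁ u} (proj₁ (proj₂ u)) (proj₂ (proj₂ u))

  -- Coordinate subspaces and the flags built from them.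

  -- Lift only raises the level to that of the predicates of a Subspace.
  coordinateSubspace : Subset n → Subspace n
  coordinateSubspace S = record
    { member   = λ x → Lift (c ⊔ ℓ₁) (∀ j → lookup S j ≡ outside → x j ≈ 0#)
    ; resp     = λ { x≋y (lift p) → lift λ j j∉S → trans (sym (x≋y j)) (p j j∉S) }
    ; 0-closed = lift λ _ _ → refl
    ; +-closed = λ { (lift p) (lift p′) → lift λ j j∉S →
                     trans (+-cong (p j j∉S) (p′ j j∉S)) (+-identityˡ 0#) }
    ; ·-closed = λ { a (lift p) → lift λ j j∉S → trans (*-cong refl (p j j∉S)) (zeroʳ a) }
    }

  coordinateSubspace-dimension : (S : Subset n) → HasDimension (coordinateSubspace S) ∣ S ∣
  coordinateSubspace-dimension [] = (λ ()) , record
    { inside = λ () ; independent = λ _ _ () ; spanning = λ _ → (λ ()) , λ () }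
  coordinateSubspace-dimension (inside ∷ S) = adjoinUnit b , record
    { inside      = λ where
        zero    → lift λ { zero () ; (suc j) _ → refl }
        (suc i) → lift λ { zero () ; (suc j) j∉S → lower (b.inside i) j j∉S }
    ; independent = adjoinUnit-independent b.independent
    ; spanning    = λ {x} x∈S →
        let a , x≋ = b.spanning {x ∘ suc} (lift λ j → lower x∈S (suc j)) in
        x zero Vector.∷ a , λ where
          zero    → sym (adjoinUnit-head b (x zero Vector.∷ a))
          (suc j) → trans (x≋ j) (sym (adjoinUnit-tail b (x zero Vector.∷ a) j))
    }
    where
    b = proj₁ (coordinateSubspace-dimension S)
    module b = IsBasis (proj₂ (coordinateSubspace-dimension S))
  coordinateSubspace-dimension (outside ∷ S) = (λ i → 0# Vector.∷ b i) , record
    { inside      = λ i → lift λ { zero _ → refl ; (suc j) j∉S → lower (b.inside i) j j∉S }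
    ; independent = λ a eq → b.independent a (eq ∘ suc)
    ; spanning    = λ {x} x∈S →
        let a , x≋ = b.spanning {x ∘ suc} (lift λ j → lower x∈S (suc j)) in
        a , λ where
          zero    → trans (lower x∈S zero ≡.refl) (sym (sum-zeroʳ a))
          (suc j) → x≋ j
    }
    where
    b = proj₁ (coordinateSubspace-dimension S)
    module b = IsBasis (proj₂ (coordinateSubspace-dimension S))

  coordinateSubspace-mono : (S T : Subset n) →
    (∀ j → lookup T j ≡ outside → lookup S j ≡ outside) →
    member (coordinateSubspace S) ⊆ member (coordinateSubspace T)
  coordinateSubspace-mono S T S⊆T (lift x∈S) = lift λ j j∉T → x∈S j (S⊆T j j∉T)

  -- Vanishing outside S and outside T amounts to vanishing outside S ∩ T.
  coordinateSubspace-∩-dimension : (S T : Subset n) →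
    HasDimension (coordinateSubspace S ∩ˢ coordinateSubspace T) ∣ S ∩ T ∣
  coordinateSubspace-∩-dimension S T = dimension-resp
    {V = coordinateSubspace (S ∩ T)} {coordinateSubspace S ∩ˢ coordinateSubspace T}
    (λ x∈ →
      coordinateSubspace-mono (S ∩ T) S (λ j j∉S →
        ≡.trans (lookup-∩ j) (≡.cong (_∧ lookup T j) j∉S)) x∈ ,
      coordinateSubspace-mono (S ∩ T) T (λ j j∉T →
        ≡.trans (lookup-∩ j) (≡.trans (≡.cong (lookup S j ∧_) j∉T) (∧-zeroʳ (lookup S j)))) x∈)
    (λ { {x} (lift x∈S , lift x∈T) → lift λ j j∉ →
      either (x∈S j) (x∈T j) (≡.trans (≡.sym (lookup-∩ j)) j∉) })
    (coordinateSubspace-dimension (S ∩ T))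
    where
    lookup-∩ : ∀ j → lookup (S ∩ T) j ≡ lookup S j ∧ lookup T j
    lookup-∩ j = Vec.lookup-zipWith _∧_ j S T
    either : ∀ {ℓ} {A : Set ℓ} {s t : Bool} → (s ≡ false → A) → (t ≡ false → A) → s ∧ t ≡ false → A
    either {s = false} f g _  = f ≡.refl
    either {s = true}  f g eq = g eq

  coordinateFlag : SubsetChain (suc k) → FullFlag (suc k)
  coordinateFlag {k} S = record
    { space      = λ i → coordinateSubspace (subset S (suc (toℕ i)))
    ; increasing = λ {i} {j} i<j →
        coordinateSubspace-mono (subset S (suc (toℕ i))) (subset S (suc (toℕ j)))
          (SubsetChain.monotone S (s≤s (ℕ.<⇒≤ i<j))) ,
        -- Strictness: the reverse inclusion would contradict the dimensions.
        λ Sⱼ⊆Sᵢ → ℕ.<⇒≱ (s≤s i<j) (dimension-mono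
          {V = coordinateSubspace (subset S (suc (toℕ j)))}
          {coordinateSubspace (subset S (suc (toℕ i)))} Sⱼ⊆Sᵢ (dimension j) (dimension i))
    ; dimension  = dimension
    }
    where
    dimension : ∀ i → HasDimension (coordinateSubspace (subset S (suc (toℕ i)))) (suc (toℕ i))
    dimension i = ≡.subst (HasDimension (coordinateSubspace (subset S (suc (toℕ i)))))
      (SubsetChain.size S (s≤s (ℕ.<⇒≤ (Fin.toℕ<n i))))
      (coordinateSubspace-dimension (subset S (suc (toℕ i))))

  -- Only the interior heights: the two end heights are 0 and left out, like the zero space and the
  -- whole space in a flag.
  heights : Path 0 (suc k) → Vec ℤ k
  heights P = Vec.tabulate λ i → + height P (suc (toℕ i))

  heights-realized : (P : Path 0 (suc k)) → ∃ λ (F : FullFlag (suc k)) →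
    ∃ λ (F′ : FullFlag (suc k)) → IsDistanceVector F F′ (heights P)
  heights-realized P =
    let S , T , both = subsetChains P in
    coordinateFlag S , coordinateFlag T , λ i →
      let Sᵢ = subset S (suc (toℕ i)) ; Tᵢ = subset T (suc (toℕ i)) in
      suc (toℕ i) , ∣ Sᵢ ∩ Tᵢ ∣ ,
      FullFlag.dimension (coordinateFlag S) i , FullFlag.dimension (coordinateFlag T) i ,
      coordinateSubspace-∩-dimension Sᵢ Tᵢ ,
      ≡.trans (Vec.lookup∘tabulate _ i)
        (difference ∣ Sᵢ ∩ Tᵢ ∣ (height P (suc (toℕ i))) (both (s≤s (ℕ.<⇒≤ (Fin.toℕ<n i)))))
    where
    difference : ∀ a b {c} → a ℕ.+ b ≡ c → + b ≡ + c ℤ.- + a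
    difference a b ≡.refl = ≡.sym (≡.trans (ℤ.m-n≡m⊖n (a ℕ.+ b) a)
      (≡.trans (ℤ.⊖-≥ (ℕ.m≤m+n a b)) (≡.cong +_ (ℕ.m+n∸m≡n a b))))

  -- From pairs of flags to Motzkin paths.

  -- The flag completed by the zero space at 0 and by the whole space from `suc k` on, so that the
  -- steps at both ends need no separate treatment.
  extend : FullFlag (suc k) → ℕ → Subspace (suc k)
  extend F zero = coordinateSubspace ⊥
  extend {k} F (suc j) with j ℕ.<? k
  ... | yes j<k = space F (fromℕ< j<k)
  ... | no  _   = coordinateSubspace ⊤

  ⊤-full : {W : Subspace n} → member W ⊆ member (coordinateSubspace ⊤)
  ⊤-full _ = lift λ j j∉⊤ → contradiction (≡.trans (≡.sym (Vec.lookup-replicate j inside)) j∉⊤) λ ()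

  ⊥-trivial : {W : Subspace n} → member (coordinateSubspace ⊥) ⊆ member W
  ⊥-trivial {W = W} (lift x≈0) =
    Subspace.resp W (λ j → sym (x≈0 j (Vec.lookup-replicate j outside))) (Subspace.0-closed W)

  ⊥-dimension : HasDimension {n} (coordinateSubspace ⊥) 0
  ⊥-dimension {n} = ≡.subst (HasDimension (coordinateSubspace ⊥)) (∣⊥∣≡0 n) (coordinateSubspace-dimension ⊥)

  ⊤-dimension : HasDimension {n} (coordinateSubspace ⊤) n
  ⊤-dimension {n} = ≡.subst (HasDimension (coordinateSubspace ⊤)) (∣⊤∣≡n n) (coordinateSubspace-dimension ⊤)

  extend-mono : (F : FullFlag (suc k)) (i : ℕ) → member (extend F i) ⊆ member (extend F (suc i))
  extend-mono F zero = ⊥-trivial {W = extend F 1}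
  extend-mono {k} F (suc j) with j ℕ.<? k | suc j ℕ.<? k
  ... | yes p | yes p′ = proj₁ (FullFlag.increasing F
          (ℕ.≤-reflexive (≡.trans (≡.cong suc (Fin.toℕ-fromℕ< p)) (≡.sym (Fin.toℕ-fromℕ< p′)))))
  ... | yes p | no  _  = ⊤-full {W = space F (fromℕ< p)}
  ... | no ¬p | yes p′ = contradiction (ℕ.<-trans (ℕ.n<1+n j) p′) ¬p
  ... | no  _ | no  _  = λ x∈ → x∈

  extend-dimension : (F : FullFlag (suc k)) {i : ℕ} → i ℕ.≤ suc k → HasDimension (extend F i) i
  extend-dimension F {zero} _ = ⊥-dimension
  extend-dimension {k} F {suc j} (s≤s j≤k) with j ℕ.<? k
  ... | yes p = ≡.subst (HasDimension (space F (fromℕ< p))) (≡.cong suc (Fin.toℕ-fromℕ< p))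
                  (FullFlag.dimension F (fromℕ< p))
  ... | no ¬p = ≡.subst (HasDimension (coordinateSubspace ⊤)) (≡.cong suc (ℕ.≤-antisym (ℕ.≮⇒≥ ¬p) j≤k))
                  ⊤-dimension

  module _ {k : ℕ} {F F′ : FullFlag (suc k)} {d : Vec ℤ k} (isDist : IsDistanceVector F F′ d) where

    meet : Fin k → ℕ
    meet i = proj₁ (proj₂ (isDist i))

    meet-dimension : ∀ i → HasDimension (space F i ∩ˢ space F′ i) (meet i)
    meet-dimension i = proj₁ (proj₂ (proj₂ (proj₂ (proj₂ (isDist i)))))

    meet≤ : ∀ i → meet i ℕ.≤ suc (toℕ i)
    meet≤ i = dimension-mono {V = space F i ∩ˢ space F′ i} {space F i} proj₁
      (meet-dimension i) (FullFlag.dimension F i)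

    -- An injection distance comes with some dimension as a witness; uniqueness of dimension
    -- identifies it with `suc (toℕ i)`, and `meet≤` makes the truncated subtraction exact.
    distance-≡ : ∀ i → lookup d i ≡ + (suc (toℕ i) ∸ meet i)
    distance-≡ i with isDist i | meet≤ i
    ... | l , a , dim , _ , _ , eq | a≤
      rewrite dimension-unique {V = space F i} dim (FullFlag.dimension F i) =
      ≡.trans eq (≡.trans (ℤ.m-n≡m⊖n (suc (toℕ i)) a) (ℤ.⊖-≥ a≤))

    -- At the added ends both flags have the same space, so the intersection has its dimension, 0 or
    -- `suc k`.
    extendedMeet : ∀ i → ∃ λ a → HasDimension (extend F i ∩ˢ extend F′ i) a × a ℕ.≤ i
    extendedMeet zero = 0 , dimension-resp
      {V = coordinateSubspace ⊥} {coordinateSubspace ⊥ ∩ˢ coordinateSubspace ⊥}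
      (λ x∈ → x∈ , x∈) proj₁ ⊥-dimension , z≤n
    extendedMeet (suc j) with j ℕ.<? k
    ... | yes p = meet (fromℕ< p) , meet-dimension (fromℕ< p) ,
            ≡.subst (meet (fromℕ< p) ℕ.≤_) (≡.cong suc (Fin.toℕ-fromℕ< p)) (meet≤ (fromℕ< p))
    ... | no ¬p = suc k , dimension-resp
            {V = coordinateSubspace ⊤} {coordinateSubspace ⊤ ∩ˢ coordinateSubspace ⊤}
            (λ x∈ → x∈ , x∈) proj₁ ⊤-dimension , s≤s (ℕ.≮⇒≥ ¬p)

    distance : ℕ → ℕ
    distance i = i ∸ proj₁ (extendedMeet i)

    distance-end : distance (suc k) ≡ 0
    distance-end with k ℕ.<? k
    ... | yes k<k = contradiction k<k (ℕ.<-irrefl ≡.refl)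
    ... | no  _   = ℕ.n∸n≡0 k

    lookup-distance : ∀ i → lookup d i ≡ + distance (suc (toℕ i))
    lookup-distance i with toℕ i ℕ.<? k
    ... | yes p rewrite Fin.fromℕ<-toℕ i p = distance-≡ i
    ... | no ¬p = contradiction (Fin.toℕ<n i) ¬p

    distance-adjacent : ∀ i → i ℕ.< suc k → Adjacent (distance i) (distance (suc i))
    distance-adjacent i i≤k =
      let a , a-dim , a≤ = extendedMeet i
          b , b-dim , b≤ = extendedMeet (suc i)
      in ∸-adjacent a≤ b≤
        (dimension-mono {V = extend F i ∩ˢ extend F′ i} {extend F (suc i) ∩ˢ extend F′ (suc i)}
          (λ (x∈ , x∈′) → extend-mono F i x∈ , extend-mono F′ i x∈′) a-dim b-dim)
        (dimension-∩-step {V = extend F i} {extend F (suc i)} {extend F′ i} {extend F′ (suc i)}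
          (extend-mono F i) (extend-mono F′ i)
          (extend-dimension F (ℕ.<⇒≤ i≤k)) (extend-dimension F i≤k)
          (extend-dimension F′ (ℕ.<⇒≤ i≤k)) (extend-dimension F′ i≤k) a-dim b-dim)

    distancePath : ∃ λ (P : Path 0 (suc k)) → d ≡ heights P
    distancePath =
      let P , eq = pathThrough distance (suc k) distance-adjacent distance-end in
      P , heights-≡ P eq
      where
      heights-≡ : (P : Path 0 (suc k)) → (∀ i → i ℕ.≤ suc k → height P i ≡ distance i) → d ≡ heights P
      heights-≡ P eq = ≡.trans (≡.sym (Vec.tabulate∘lookup d)) (Vec.tabulate-cong λ i →
        ≡.trans (lookup-distance i) (≡.cong +_ (≡.sym (eq (suc (toℕ i)) (s≤s (ℕ.<⇒≤ (Fin.toℕ<n i)))))))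

  -- Distance vectors, heights and words determine one another.

  -- The height at 0 is fixed by the type and those beyond k are 0, so the recorded heights are
  -- enough.
  heights-injective : (P P′ : Path 0 (suc k)) → heights P ≡ heights P′ → P ≡ P′
  heights-injective {k} P P′ eq = height-injective P P′
    λ { zero → ≡.refl ; (suc j) → case-< j (j ℕ.<? k) }
    where
    case-< : ∀ j → Dec (j ℕ.< k) → height P (suc j) ≡ height P′ (suc j)
    case-< j (yes j<k) = ≡.subst (λ j → height P (suc j) ≡ height P′ (suc j)) (Fin.toℕ-fromℕ< j<k)
      (ℤ.+-injective (≡.trans (≡.sym (Vec.lookup∘tabulate _ (fromℕ< j<k)))
        (≡.trans (≡.cong (λ v → lookup v (fromℕ< j<k)) eq) (Vec.lookup∘tabulate _ (fromℕ< j<k)))))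
    case-< j (no  j≮k) = ≡.trans (height-beyond P (s≤s (ℕ.≮⇒≥ j≮k)))
      (≡.sym (height-beyond P′ (s≤s (ℕ.≮⇒≥ j≮k))))

  bijection : (k : ℕ) → Bijection (𝒟 K (suc k)) (ℳ (suc k))
  bijection k = record
    { to        = λ d → word (path d) , word-isMotzkin (path d)
    ; cong      = λ {d} {d′} eq → ≡.cong word (path-cong d d′ eq)
    ; bijective = (λ {d} {d′} eq → injective d d′ eq) , surjective
    }
    where
    path : DistanceVector (suc k) → Path 0 (suc k)
    path (d , F , F′ , isDist) = proj₁ (distancePath {F = F} {F′} {d} isDist)
    path-heights : (d : DistanceVector (suc k)) → proj₁ d ≡ heights (path d)
    path-heights (d , F , F′ , isDist) = proj₂ (distancePath {F = F} {F′} {d} isDist)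
    -- `path` is computed from the witnessing flags; since its heights are the vector itself, it
    -- depends on the vector only.
    path-cong : ∀ d d′ → proj₁ d ≡ proj₁ d′ → path d ≡ path d′
    path-cong d d′ eq = heights-injective (path d) (path d′)
      (≡.trans (≡.sym (path-heights d)) (≡.trans eq (path-heights d′)))
    injective : ∀ d d′ → word (path d) ≡ word (path d′) → proj₁ d ≡ proj₁ d′
    injective d d′ eq = ≡.trans (path-heights d)
      (≡.trans (≡.cong heights (word-injective (path d) (path d′) eq)) (≡.sym (path-heights d′)))
    surjective : (w : Setoid.Carrier (ℳ (suc k))) → ∃ λ (d : DistanceVector (suc k)) →
      ∀ {d′ : DistanceVector (suc k)} → proj₁ d′ ≡ proj₁ d → word (path d′) ≡ proj₁ w
    surjective (w , isMotzkin) =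
      let module M = IsMotzkin isMotzkin
          P , word-P = word-surjective w 0ℤ M.neverBelow (≡.cong proj₂ M.endpoint)
      in (heights P , heights-realized P) , λ {d′} eq →
        ≡.trans (≡.cong word (heights-injective (path d′) P
          (≡.trans (≡.sym (path-heights d′)) eq))) word-P

theorem4p2 : ∀ {c ℓ₁ ℓ₂ : Level} (q : ℕ) → IsPrimePower q →
    (𝔽q : HeytingField c ℓ₁ ℓ₂) → HasCardinality 𝔽q q →
    (n : ℕ) → n ≥ 2 →
    Bijection (𝒟 𝔽q n) (ℳ n)
theorem4p2 q _ 𝔽q card (suc k) _ = FiniteLinearAlgebra.bijection 𝔽q q card k
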